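{- Fix a nonempty partition $\lambda$. For $n>|\lambda|+\lambda_1$ let $N(n)$ be the number of standard Young tableaux of shape $\lambda[n]$, and let $G(n)$ be the number of those standard Young tableaux $T[n]$ of shape $\lambda[n]$ (where $T$ is the part below the top row, of shape $\lambda$) such that any two entries of $T$ differ by at least $2$ and $2$ and $n$ are not both entries of $T$. Then $\lim_{n\to\infty} G(n)/N(n)=1$.
   Context: For a partition $\lambda=(\lambda_1\ge\dots\ge\lambda_\ell)$ with $|\lambda|=\lambda_1+\dots+\lambda_\ell$, $\lambda[n]$ is the partition of $n$ obtained by adding a new largest part of size $n-|\lambda|$ (i.e. $(n-|\lambda|,\lambda_1,\dots,\lambda_\ell)$). For a tableau $T$ with distinct positive entries, $T[n]$ denotes the tableau obtained by placing above $T$ a top row consisting of all elements of $\{1,\dots,n\}$ not in $T$, in increasing order. A standard Young tableau with $n$ boxes has entries $1,\dots,n$ increasing along rows and down columns. -}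

module Defs where

open import Data.Integer using (+_)
open import Data.List using (List; []; _∷_; _++_; [_]; map; length; concat; filter; drop; applyUpTo; cartesianProductWith)
open import Data.List.Membership.DecPropositional using () renaming (_∈?_ to mem?)
open import Data.List.Membership.Propositional using (_∈_)
open import Data.List.Membership.Propositional.Properties using (∈-filter⁺; ∈-filter⁻; ∈-cartesianProductWith⁺; ∈-length)
open import Data.List.Properties using (≡-dec; ∷-injective)
open import Data.List.Relation.Binary.Permutation.Propositional using (_↭_; ↭-sym; ↭-trans; ↭-reflexive; ↭⇒↭ₛ)
open import Data.List.Relation.Binary.Permutation.Propositional.Properties using (∈-resp-↭)
open import Data.List.Relation.Binary.Pointwise using (Pointwise-≡⇒≡)
open import Data.List.Relation.Binary.Prefix.Heterogeneous using (Prefix; []; _∷_)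
open import Data.List.Relation.Binary.Prefix.Heterogeneous.Properties using (prefix?)
open import Data.List.Relation.Unary.All as All using (All; []; _∷_)
open import Data.List.Relation.Unary.All.Properties using (++⁻ˡ; ++⁻ʳ)
open import Data.List.Relation.Unary.AllPairs using (AllPairs; []; _∷_; allPairs?)
open import Data.List.Relation.Unary.Any using (here)
open import Data.List.Relation.Unary.Linked using (Linked; []; [-]; _∷_; linked?)
open import Data.List.Relation.Unary.Sorted.TotalOrder.Properties using (↗↭↗⇒≋)
open import Data.List.Relation.Unary.Unique.Propositional using (Unique)
import Data.List.Relation.Unary.Unique.Propositional.Properties as Unique
import Data.List.Sort.MergeSort as MergeSort
open import Data.List.Sort.Base using (SortingAlgorithm)
open import Data.Nat using (ℕ; zero; suc; _+_; _∸_; _≤_; _<_; _≥_; _>_; ∣_-_∣; NonZero; z≤n; s≤s; >-nonZero)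
open import Data.Nat.ListAction using (sum)
open import Data.Nat.Properties using (_≟_; _≤?_; _<?_; _>?_; <⇒≤; ≤-<-trans; n<1+n; m≤m+n; m<m+n; m+n≤o⇒m≤o∸n; m∸n+n≡m; m<n⇒0<n∸m; +-comm; +-suc; +-identityʳ; <-irrefl; ≤-reflexive; ≤-totalOrder; ≤-decTotalOrder)
open import Data.Product using (∃-syntax; _×_; _,_; proj₂; uncurry)
open import Data.Rational as ℚ using (ℚ; 0ℚ)
open import Function using (_∘_)
open import Function.Bundles using (_⇔_; mk⇔; module Equivalence)
open import Relation.Binary.PropositionalEquality using (_≡_; refl; sym; trans; cong; cong₂)
open import Relation.Nullary using (¬_; Dec; ¬?; _×-dec_)
open import Relation.Nullary.Decidable using (map′)

record IsPartition (ν : List ℕ) : Set where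
  field
    decreasing : Linked _≥_ ν
    positive   : All (_> 0) ν

size : List ℕ → ℕ
size = sum

largest : List ℕ → ℕ
largest []      = 0
largest (p ∷ _) = p

-- Truncated subtraction: only meaningful for n ≥ size ν.
_[_]ₚ : List ℕ → ℕ → List ℕ
ν [ n ]ₚ = (n ∸ size ν) ∷ ν

size-[]ₚ : ∀ {ν n} → n > size ν + largest ν → size (ν [ n ]ₚ) ≡ n
size-[]ₚ {ν} n> = m∸n+n≡m (<⇒≤ (≤-<-trans (m≤m+n (size ν) (largest ν)) n>))

isPartition-[]ₚ : ∀ {ν n} → IsPartition ν → n > size ν + largest ν → IsPartition (ν [ n ]ₚ)
isPartition-[]ₚ {ν} {n} p n> = record
  { decreasing = cons ν (IsPartition.decreasing p) n>
  ; positive   = m<n⇒0<n∸m (≤-<-trans (m≤m+n (size ν) (largest ν)) n>) ∷ IsPartition.positive p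
  }
  where
  cons : ∀ ν → Linked _≥_ ν → n > size ν + largest ν → Linked _≥_ (ν [ n ]ₚ)
  cons []      _ _ = [-]
  cons (q ∷ ν) d h = m+n≤o⇒m≤o∸n q
    (<⇒≤ (≤-<-trans (≤-reflexive (+-comm q (size (q ∷ ν)))) h)) ∷ d

-- The list of rows, from top to bottom.
Tableau : Set
Tableau = List (List ℕ)

shape : Tableau → List ℕ
shape = map length

entries : Tableau → List ℕ
entries = concat

oneTo : ℕ → List ℕ
oneTo = applyUpTo suc

-- In `columns`, Prefix _>_ lower upper says that the lower row is at most
-- as long as the upper one and that each of its entries exceeds the entry
-- directly above it.
record IsStandard (ν : List ℕ) (U : Tableau) : Set where
  constructor isStandard
  field
    hasShape : shape U ≡ ν
    content  : entries U ↭ oneTo (size ν)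
    rows     : All (Linked _<_) U
    columns  : Linked (λ upper lower → Prefix _>_ lower upper) U

infix 4 _∈?_ _↭?_

_∈?_ : (x : ℕ) (xs : List ℕ) → Dec (x ∈ xs)
_∈?_ = mem? _≟_

_↭?_ : (xs ys : List ℕ) → Dec (xs ↭ ys)
xs ↭? ys = map′ from to (≡-dec _≟_ (sort xs) (sort ys))
  where
  open SortingAlgorithm (MergeSort.mergeSort ≤-decTotalOrder) using (sort; sort-↭; sort-↗)
  from : sort xs ≡ sort ys → xs ↭ ys
  from eq = ↭-trans (↭-sym (sort-↭ xs)) (↭-trans (↭-reflexive eq) (sort-↭ ys))
  to : xs ↭ ys → sort xs ≡ sort ys
  to p = Pointwise-≡⇒≡ (↗↭↗⇒≋ ≤-totalOrder (sort-↗ xs) (sort-↗ ys)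
    (↭⇒↭ₛ (↭-trans (sort-↭ xs) (↭-trans p (↭-sym (sort-↭ ys))))))

isStandard? : ∀ ν U → Dec (IsStandard ν U)
isStandard? ν U = map′
  (λ (s , c , r , k) → isStandard s c r k)
  (λ (isStandard s c r k) → s , c , r , k)
  (≡-dec _≟_ (shape U) ν
    ×-dec (entries U ↭? oneTo (size ν))
    ×-dec All.all? (linked? _<?_) U
    ×-dec linked? (λ upper lower → prefix? _>?_ lower upper) U)

words : List ℕ → ℕ → List (List ℕ)
words xs zero    = [ [] ]
words xs (suc m) = cartesianProductWith _∷_ xs (words xs m)

fillings : List ℕ → List ℕ → List Tableau
fillings xs []      = [ [] ]
fillings xs (m ∷ ν) = cartesianProductWith _∷_ (words xs m) (fillings xs ν)

standardTableaux : List ℕ → List Tableau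
standardTableaux ν = filter (isStandard? ν) (fillings (oneTo (size ν)) ν)

-- The list above contains each standard tableau of shape ν exactly once, so
-- that its length is their number.

∈-words : ∀ {xs} w → All (_∈ xs) w → w ∈ words xs (length w)
∈-words []      []       = here refl
∈-words (x ∷ w) (p ∷ ps) = ∈-cartesianProductWith⁺ _∷_ p (∈-words w ps)

∈-fillings : ∀ {xs} U → All (_∈ xs) (entries U) → U ∈ fillings xs (shape U)
∈-fillings []      ps = here refl
∈-fillings (r ∷ U) ps = ∈-cartesianProductWith⁺ _∷_
  (∈-words r (++⁻ˡ r ps)) (∈-fillings U (++⁻ʳ r ps))

∈-standardTableaux : ∀ {ν U} → U ∈ standardTableaux ν ⇔ IsStandard ν U
∈-standardTableaux {ν} {U} = mk⇔
  (proj₂ ∘ ∈-filter⁻ (isStandard? ν) {xs = fillings (oneTo (size ν)) ν})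
  (λ st → ∈-filter⁺ (isStandard? ν) (candidate st) st)
  where
  candidate : IsStandard ν U → U ∈ fillings (oneTo (size ν)) ν
  candidate (isStandard refl c _ _) = ∈-fillings U (All.tabulate (∈-resp-↭ c))

words-unique : ∀ {xs} → Unique xs → ∀ m → Unique (words xs m)
words-unique xs! zero    = [] ∷ []
words-unique xs! (suc m) =
  Unique.cartesianProductWith⁺ _∷_ ∷-injective xs! (words-unique xs! m)

fillings-unique : ∀ {xs} → Unique xs → ∀ ν → Unique (fillings xs ν)
fillings-unique xs! []      = [] ∷ []
fillings-unique xs! (m ∷ ν) =
  Unique.cartesianProductWith⁺ _∷_ ∷-injective (words-unique xs! m) (fillings-unique xs! ν)

oneTo-unique : ∀ n → Unique (oneTo n)
oneTo-unique n = Unique.applyUpTo⁺₁ suc n λ { i<j _ refl → <-irrefl refl i<j }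

standardTableaux-unique : ∀ ν → Unique (standardTableaux ν)
standardTableaux-unique ν =
  Unique.filter⁺ (isStandard? ν) (fillings-unique (oneTo-unique (size ν)) ν)

_[_]ₜ : Tableau → ℕ → Tableau
T [ n ]ₜ = filter (λ x → ¬? (x ∈? entries T)) (oneTo n) ∷ T

-- AllPairs ranges over pairs of distinct positions of T.
record Separated (n : ℕ) (T : Tableau) : Set where
  constructor separated
  field
    gaps    : AllPairs (λ x y → 2 ≤ ∣ x - y ∣) (entries T)
    not-2-n : ¬ (2 ∈ entries T × n ∈ entries T)

IsGood : ℕ → Tableau → Set
IsGood n U = ∃[ T ] U ≡ T [ n ]ₜ × Separated n T

separated? : ∀ n T → Dec (Separated n T)
separated? n T = map′ (uncurry separated) (λ (separated g e) → g , e)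
  (allPairs? (λ x y → 2 ≤? ∣ x - y ∣) (entries T)
    ×-dec ¬? ((2 ∈? entries T) ×-dec (n ∈? entries T)))

isGood? : ∀ n U → Dec (IsGood n U)
isGood? n U = map′ (drop 1 U ,_) (λ { (T , refl , s) → refl , s })
  (≡-dec (≡-dec _≟_) U (drop 1 U [ n ]ₜ) ×-dec separated? n (drop 1 U))

N : List ℕ → ℕ → ℕ
N ν n = length (standardTableaux (ν [ n ]ₚ))

G : List ℕ → ℕ → ℕ
G ν n = length (filter (isGood? n) (standardTableaux (ν [ n ]ₚ)))

-- N ν n ≠ 0: fill the rows of the shape consecutively with 1, 2, 3, …
private
  range : ℕ → ℕ → List ℕ
  range a zero    = []
  range a (suc m) = a ∷ range (suc a) m

  length-range : ∀ a m → length (range a m) ≡ m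
  length-range a zero    = refl
  length-range a (suc m) = cong suc (length-range (suc a) m)

  range-++ : ∀ a m k → range a m ++ range (a + m) k ≡ range a (m + k)
  range-++ a zero    k = cong (λ b → range b k) (+-identityʳ a)
  range-++ a (suc m) k = cong (a ∷_) (trans
    (cong (λ b → range (suc a) m ++ range b k) (+-suc a m))
    (range-++ (suc a) m k))

  applyUpTo-range : ∀ (f : ℕ → ℕ) a m → (∀ i → f i ≡ a + i) → applyUpTo f m ≡ range a m
  applyUpTo-range f a zero    eq = refl
  applyUpTo-range f a (suc m) eq = cong₂ _∷_ (trans (eq 0) (+-identityʳ a))
    (applyUpTo-range (f ∘ suc) (suc a) m (λ i → trans (eq (suc i)) (+-suc a i)))

  range-increasing : ∀ a m → Linked _<_ (range a m)
  range-increasing a zero          = []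
  range-increasing a (suc zero)    = [-]
  range-increasing a (suc (suc m)) = n<1+n a ∷ range-increasing (suc a) (suc m)

  range-prefix : ∀ {a b m k} → k ≤ m → a < b → Prefix _>_ (range b k) (range a m)
  range-prefix z≤n       a<b = []
  range-prefix (s≤s k≤m) a<b = a<b ∷ range-prefix k≤m (s≤s a<b)

  range-below : ∀ a {m k} → k ≤ m → Prefix _>_ (range (a + m) k) (range a m)
  range-below a z≤n         = []
  range-below a k≤m@(s≤s _) = range-prefix k≤m (m<m+n a (s≤s z≤n))

  fill : ℕ → List ℕ → Tableau
  fill a []      = []
  fill a (m ∷ ν) = range a m ∷ fill (a + m) ν

  shape-fill : ∀ a ν → shape (fill a ν) ≡ ν
  shape-fill a []      = refl
  shape-fill a (m ∷ ν) = cong₂ _∷_ (length-range a m) (shape-fill (a + m) ν)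

  entries-fill : ∀ a ν → entries (fill a ν) ≡ range a (size ν)
  entries-fill a []      = refl
  entries-fill a (m ∷ ν) = trans
    (cong (range a m ++_) (entries-fill (a + m) ν)) (range-++ a m (size ν))

  rows-fill : ∀ a ν → All (Linked _<_) (fill a ν)
  rows-fill a []      = []
  rows-fill a (m ∷ ν) = range-increasing a m ∷ rows-fill (a + m) ν

  columns-fill : ∀ a {ν} → Linked _≥_ ν →
                 Linked (λ upper lower → Prefix _>_ lower upper) (fill a ν)
  columns-fill a []       = []
  columns-fill a [-]      = [-]
  columns-fill a (m≥k ∷ d) = range-below a m≥k ∷ columns-fill (a + _) d

  fill-standard : ∀ {ν} → Linked _≥_ ν → IsStandard ν (fill 1 ν)
  fill-standard {ν} d = isStandard
    (shape-fill 1 ν)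
    (↭-reflexive (trans (entries-fill 1 ν)
                        (sym (applyUpTo-range suc 1 (size ν) (λ _ → refl)))))
    (rows-fill 1 ν)
    (columns-fill 1 d)

N-nonZero : ∀ {ν n} → IsPartition ν → n > size ν + largest ν → NonZero (N ν n)
N-nonZero {ν} {n} p n> = >-nonZero (∈-length
  (Equivalence.from ∈-standardTableaux
    (fill-standard (IsPartition.decreasing (isPartition-[]ₚ p n>)))))

ratio : ∀ {ν} → IsPartition ν → ∀ n → n > size ν + largest ν → ℚ
ratio {ν} p n n> = ((+ G ν n) ℚ./ N ν n) {{N-nonZero p n>}}

-- f is only defined at indices n > n₀.
ConvergesTo : (n₀ : ℕ) → (∀ n → n > n₀ → ℚ) → ℚ → Set
ConvergesTo n₀ f ℓ =
  ∀ ε → ε ℚ.> 0ℚ → ∃[ M ] ∀ n (n> : n > n₀) → n ≥ M → ℚ.∣ f n n> ℚ.- ℓ ∣ ℚ.< ε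

{-# OPTIONS --safe #-}
-- Write k = |λ| and let the reading word of T list its entries row by row; it
-- determines T[n].  The tableau is bad only if two letters of the word conflict
-- (they differ by at most 1, or are 2 and n), and one of them is then determined up to
-- O(k) choices by the rest of the word: there are O(n^(k-1)) bad tableaux.
-- Conversely, cut {λ₁ + 1, …, n} into k blocks of length m proportional to n and
-- choose one letter in each: these increasing words are all reading words of
-- standard tableaux, since the top row then starts with 1, …, λ₁.  Hence
-- N(n) ≥ m^k, and the proportion of bad tableaux is O(1/n).

module Submission where

open import Defs
open import Data.Integer as ℤ using (+[1+_]; -[1+_]; +<+)
import Data.Integer.Properties as ℤ
open import Data.List using (List; []; _∷_; _++_; map; length; concatMap; filter; take; drop; applyUpTo; cartesianProductWith)
open import Data.List.Membership.Propositional using (_∈_; _∉_; lose)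
open import Data.List.Membership.Propositional.Properties using (∈-∃++; ∈-++⁺ˡ; ∈-++⁺ʳ; ∈-++⁻; ∈-map⁺; ∈-filter⁺; ∈-filter⁻; ∈-applyUpTo⁺; ∈-applyUpTo⁻; ∈-cartesianProductWith⁺; ∈-cartesianProductWith⁻; ∈-concatMap⁺)
open import Data.List.Membership.Propositional.Properties.WithK using (unique∧set⇒bag)
open import Data.List.Properties using (length-map; length-++; length-applyUpTo; length-take; length-drop; take++drop≡id; filter-all; filter-none; filter-++; ++-identityʳ; ∷-injective)
open import Data.List.Relation.Binary.BagAndSetEquality using (∼bag⇒↭)
open import Data.List.Relation.Binary.Permutation.Propositional using (_↭_; ↭-sym; ↭⇒↭ₛ)
open import Data.List.Relation.Binary.Permutation.Propositional.Properties using (∈-resp-↭; ↭-length; filter-↭)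
open import Data.List.Relation.Binary.Permutation.Setoid.Properties using (Unique-resp-↭)
open import Data.List.Relation.Binary.Pointwise using (Pointwise-≡⇒≡)
open import Data.List.Relation.Binary.Prefix.Heterogeneous using (Prefix; []; _∷_; _++ᵖ_)
open import Data.List.Relation.Binary.Subset.Propositional using (_⊆_)
open import Data.List.Relation.Unary.All as All using (All; []; _∷_)
import Data.List.Relation.Unary.All.Properties as All
open import Data.List.Relation.Unary.AllPairs as AllPairs using (AllPairs; []; _∷_)
import Data.List.Relation.Unary.AllPairs.Properties as AllPairs
open import Data.List.Relation.Unary.Any using (here; there)
open import Data.List.Relation.Unary.Linked as Linked using (Linked; []; [-]; _∷_)
open import Data.List.Relation.Unary.Linked.Properties as Linked using (AllPairs⇒Linked)
open import Data.List.Relation.Unary.Sorted.TotalOrder.Properties using (↗↭↗⇒≋)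
open import Data.List.Relation.Unary.Unique.Propositional using (Unique)
import Data.List.Relation.Unary.Unique.Propositional.Properties as Unique
open import Data.Nat using (ℕ; zero; suc; pred; _+_; _*_; _∸_; _^_; _/_; _%_; _≤_; _<_; _≥_; _>_; ∣_-_∣; NonZero; >-nonZero; z≤n; s≤s; z<s)
open import Data.Nat.DivMod using (m/n*n≤m; m≡m%n+[m/n]*n; m%n<n; m≥n⇒m/n>0)
open import Data.Nat.Properties
open import Data.Nat.Tactic.RingSolver using (solve-∀)
open import Data.Product using (_×_; _,_; proj₁; proj₂)
open import Data.Rational as ℚ using (0ℚ; 1ℚ; mkℚ)
import Data.Rational.Properties as ℚ
open import Data.Rational.Unnormalised as ℚᵘ using (1ℚᵘ; mkℚᵘ; *<*)
import Data.Rational.Unnormalised.Properties as ℚᵘ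
open import Data.Sum using (_⊎_; inj₁; inj₂; fromInj₁)
open import Function using (_∘_; mk⇔)
open import Function.Bundles using (module Equivalence)
open import Relation.Binary.PropositionalEquality using (_≡_; _≢_; refl; sym; trans; cong; cong₂; subst; subst₂; setoid; module ≡-Reasoning)
open import Relation.Nullary using (¬_; yes; no; ¬?; contradiction)
open import Relation.Unary using (Decidable)

-- Counting in finite lists.

private
  variable
    A B C : Set

Unique∧⊆⇒length≤ : {xs ys : List A} → Unique xs → xs ⊆ ys → length xs ≤ length ys
Unique∧⊆⇒length≤ []           _     = z≤n
Unique∧⊆⇒length≤ {xs = x ∷ xs} (x∉xs ∷ xs!) xs⊆ys with ∈-∃++ (xs⊆ys (here refl))
... | as , bs , refl = begin
  suc (length xs)               ≤⟨ s≤s (Unique∧⊆⇒length≤ xs! remaining) ⟩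
  suc (length (as ++ bs))       ≡⟨ cong suc (length-++ as) ⟩
  suc (length as + length bs)   ≡⟨ +-suc (length as) (length bs) ⟨
  length as + length (x ∷ bs)   ≡⟨ length-++ as ⟨
  length (as ++ x ∷ bs)         ∎
  where
  open ≤-Reasoning
  remaining : xs ⊆ as ++ bs
  remaining y∈xs with ∈-++⁻ as (xs⊆ys (there y∈xs))
  ... | inj₁ y∈as         = ∈-++⁺ˡ y∈as
  ... | inj₂ (here refl)  = contradiction refl (All.lookup x∉xs y∈xs)
  ... | inj₂ (there y∈bs) = ∈-++⁺ʳ as y∈bs

length-filter-¬ : ∀ {P : A → Set} (P? : Decidable P) xs →
                  length (filter P? xs) + length (filter (¬? ∘ P?) xs) ≡ length xs
length-filter-¬ P? []       = refl
length-filter-¬ P? (x ∷ xs) with P? x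
... | yes _ = cong suc (length-filter-¬ P? xs)
... | no  _ = trans (+-suc _ _) (cong suc (length-filter-¬ P? xs))

length-cartesianProductWith : ∀ (f : A → B → C) xs ys →
                              length (cartesianProductWith f xs ys) ≡ length xs * length ys
length-cartesianProductWith f []       ys = refl
length-cartesianProductWith f (x ∷ xs) ys = trans (length-++ (map (f x) ys))
  (cong₂ _+_ (length-map (f x) ys) (length-cartesianProductWith f xs ys))

length-concatMap : ∀ (f : A → List B) {c xs} → All (λ x → length (f x) ≡ c) xs →
                   length (concatMap f xs) ≡ length xs * c
length-concatMap f          []         = refl
length-concatMap f {xs = x ∷ xs} (eq ∷ eqs) =
  trans (length-++ (f x)) (cong₂ _+_ eq (length-concatMap f eqs))

-- Tableaux and their reading words.

length-entries : ∀ T → length (entries T) ≡ size (shape T)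
length-entries []      = refl
length-entries (r ∷ T) = trans (length-++ r) (cong (length r +_) (length-entries T))

AllPairs-++⁻ : ∀ {R : A → A → Set} xs {ys} → AllPairs R (xs ++ ys) →
               AllPairs R xs × AllPairs R ys × All (λ x → All (R x) ys) xs
AllPairs-++⁻ []       rs       = [] , rs , []
AllPairs-++⁻ (x ∷ xs) (r ∷ rs) =
  let rˡ , rʳ , rˣ = AllPairs-++⁻ xs rs
  in All.++⁻ˡ xs r ∷ rˡ , rʳ , All.++⁻ʳ xs r ∷ rˣ

all>⇒prefix : ∀ {xs ys} → length ys ≤ length xs → All (λ x → All (x <_) ys) xs →
              Prefix _>_ ys xs
all>⇒prefix {ys = []}                 _           _              = []
all>⇒prefix {x ∷ xs} {y ∷ ys} (s≤s le) ((x<y ∷ _) ∷ lt) =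
  x<y ∷ all>⇒prefix le (All.map All.tail lt)

increasing⇒rows : ∀ T → AllPairs _<_ (entries T) → All (Linked _<_) T
increasing⇒rows []      _   = []
increasing⇒rows (r ∷ T) inc =
  let incʳ , incᵀ , _ = AllPairs-++⁻ r inc
  in AllPairs⇒Linked incʳ ∷ increasing⇒rows T incᵀ

-- In an increasing reading word every entry of a row is smaller than every entry of the next row,
-- so the column condition reduces to a comparison of row lengths.
increasing⇒columns : ∀ T → Linked _≥_ (shape T) → AllPairs _<_ (entries T) →
                     Linked (λ upper lower → Prefix _>_ lower upper) T
increasing⇒columns []          _         _   = []
increasing⇒columns (r ∷ [])    _         _   = [-]
increasing⇒columns (r ∷ s ∷ T) (ge ∷ ges) inc =
  let _ , incᵀ , r<sT = AllPairs-++⁻ r inc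
  in all>⇒prefix ge (All.map (All.++⁻ˡ s) r<sT) ∷ increasing⇒columns (s ∷ T) ges incᵀ

-- Inverse of `entries` once the shape is fixed. `entries-splitRows` serves the lower bound on `N`,
-- `splitRows-entries` the upper bound on the bad tableaux.
splitRows : List ℕ → List ℕ → Tableau
splitRows []      w = []
splitRows (m ∷ ν) w = take m w ∷ splitRows ν (drop m w)

module _ m {k} (w : List A) (eq : length w ≡ m + k) where

  length-take-+ : length (take m w) ≡ m
  length-take-+ = trans (length-take m w) (m≤n⇒m⊓n≡m (≤-trans (m≤m+n m k) (≤-reflexive (sym eq))))

  length-drop-+ : length (drop m w) ≡ k
  length-drop-+ = trans (length-drop m w) (trans (cong (_∸ m) eq) (m+n∸m≡n m k))

shape-splitRows : ∀ ν w → length w ≡ size ν → shape (splitRows ν w) ≡ ν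
shape-splitRows []      w eq = refl
shape-splitRows (m ∷ ν) w eq = cong₂ _∷_ (length-take-+ m w eq)
  (shape-splitRows ν (drop m w) (length-drop-+ m w eq))

entries-splitRows : ∀ ν w → length w ≡ size ν → entries (splitRows ν w) ≡ w
entries-splitRows []      [] eq = refl
entries-splitRows (m ∷ ν) w  eq = trans
  (cong (take m w ++_) (entries-splitRows ν (drop m w) (length-drop-+ m w eq)))
  (take++drop≡id m w)

take-length-++ : ∀ (xs ys : List A) → take (length xs) (xs ++ ys) ≡ xs
take-length-++ []       ys = refl
take-length-++ (x ∷ xs) ys = cong (x ∷_) (take-length-++ xs ys)

drop-length-++ : ∀ (xs ys : List A) → drop (length xs) (xs ++ ys) ≡ ys
drop-length-++ []       ys = refl
drop-length-++ (x ∷ xs) ys = drop-length-++ xs ys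

splitRows-entries : ∀ T → splitRows (shape T) (entries T) ≡ T
splitRows-entries []      = refl
splitRows-entries (r ∷ T) = cong₂ _∷_ (take-length-++ r (entries T)) (trans
  (cong (splitRows (shape T)) (drop-length-++ r (entries T))) (splitRows-entries T))

-- The top row of `T [ n ]ₜ`.

∈-oneTo⁺ : ∀ {x n} → 0 < x → x ≤ n → x ∈ oneTo n
∈-oneTo⁺ {suc x} _ x<n = ∈-applyUpTo⁺ suc x<n

oneTo-increasing : ∀ n → Linked _<_ (oneTo n)
oneTo-increasing n = Linked.applyUpTo⁺₂ suc n (λ i → n<1+n (suc i))

applyUpTo-+ : ∀ (f : ℕ → A) a b →
              applyUpTo f (a + b) ≡ applyUpTo f a ++ applyUpTo (λ i → f (a + i)) b
applyUpTo-+ f zero    b = refl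
applyUpTo-+ f (suc a) b = cong (f 0 ∷_) (applyUpTo-+ (f ∘ suc) a b)

∉? : ∀ w → Decidable (_∉ w)
∉? w x = ¬? (x ∈? w)

-- For `w = entries T` this is definitionally the top row of `T [ n ]ₜ`.
missing : List ℕ → ℕ → List ℕ
missing w n = filter (∉? w) (oneTo n)

missing-increasing : ∀ w n → Linked _<_ (missing w n)
missing-increasing w n = Linked.filter⁺ (∉? w) <-trans (oneTo-increasing n)

-- Both sides are free of duplicates, so having the same members makes them permutations of each
-- other.
missing-++-↭ : ∀ {w n} → Unique w → w ⊆ oneTo n → missing w n ++ w ↭ oneTo n
missing-++-↭ {w} {n} w! w⊆ = ∼bag⇒↭ (unique∧set⇒bag
  (Unique.++⁺ (Unique.filter⁺ (∉? w) (oneTo-unique n)) w!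
    (λ (p , q) → proj₂ (∈-filter⁻ (∉? w) {xs = oneTo n} p) q))
  (oneTo-unique n) (mk⇔ to from))
  where
  to : missing w n ++ w ⊆ oneTo n
  to p with ∈-++⁻ (missing w n) p
  ... | inj₁ q = proj₁ (∈-filter⁻ (∉? w) q)
  ... | inj₂ q = w⊆ q
  from : oneTo n ⊆ missing w n ++ w
  from {x} p with x ∈? w
  ... | yes q = ∈-++⁺ʳ (missing w n) q
  ... | no ¬q = ∈-++⁺ˡ (∈-filter⁺ (∉? w) p ¬q)

-- As `w` avoids 1, ..., a, the top row begins with exactly these numbers; they cover all columns of
-- `r`, whose entries exceed a.
missing-prefix : ∀ {w n r} a → a ≤ n → All (a <_) w → All (a <_) r → length r ≤ a →
                 Prefix _>_ r (missing w n)
missing-prefix {w} {n} {r} a a≤n a<w a<r |r|≤a =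
  subst (Prefix _>_ r) (sym split) (all>⇒prefix
    (≤-trans |r|≤a (≤-reflexive (sym (length-applyUpTo suc a))))
    (All.applyUpTo⁺₁ suc a (λ i<a → All.map (≤-<-trans i<a) a<r)) ++ᵖ _)
  where
  rest : List ℕ
  rest = applyUpTo (λ i → suc (a + i)) (n ∸ a)
  split : missing w n ≡ oneTo a ++ filter (∉? w) rest
  split = begin
    missing w n                                      ≡⟨ cong (missing w) (m+[n∸m]≡n a≤n) ⟨
    missing w (a + (n ∸ a))                          ≡⟨ cong (filter (∉? w)) (applyUpTo-+ suc a (n ∸ a)) ⟩
    filter (∉? w) (oneTo a ++ rest)                  ≡⟨ filter-++ (∉? w) (oneTo a) rest ⟩
    filter (∉? w) (oneTo a) ++ filter (∉? w) rest    ≡⟨ cong (_++ filter (∉? w) rest) (filter-all (∉? w)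
      (All.applyUpTo⁺₁ suc a λ i<a i∈w → <-irrefl refl (≤-<-trans i<a (All.lookup a<w i∈w)))) ⟩
    oneTo a ++ filter (∉? w) rest                    ∎
    where open ≡-Reasoning

-- Increasing words with one letter in each block.

-- The first letter ranges over b + 1, ..., b + m, the next over the following m numbers, and so on.
-- Since the blocks are consecutive, independent choices always give an increasing word, which makes
-- the count an exact power.
increasingWords : ℕ → ℕ → ℕ → List (List ℕ)
increasingWords b m zero    = [] ∷ []
increasingWords b m (suc k) =
  cartesianProductWith _∷_ (applyUpTo (λ i → suc (b + i)) m) (increasingWords (b + m) m k)

length-increasingWords : ∀ b m k → length (increasingWords b m k) ≡ m ^ k
length-increasingWords b m zero    = refl
length-increasingWords b m (suc k) = trans
  (length-cartesianProductWith _∷_ (applyUpTo _ m) _)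
  (cong₂ _*_ (length-applyUpTo _ m) (length-increasingWords (b + m) m k))

increasingWords-unique : ∀ b m k → Unique (increasingWords b m k)
increasingWords-unique b m zero    = [] ∷ []
increasingWords-unique b m (suc k) = Unique.cartesianProductWith⁺ _∷_ ∷-injective
  (Unique.applyUpTo⁺₁ _ m λ i<j _ eq → <⇒≢ i<j (+-cancelˡ-≡ b _ _ (suc-injective eq)))
  (increasingWords-unique (b + m) m k)

record IncreasingWord (b c k : ℕ) (w : List ℕ) : Set where
  field
    length≡    : length w ≡ k
    increasing : AllPairs _<_ w
    lower      : All (b <_) w
    upper      : All (_≤ c) w

∈-increasingWords⁻ : ∀ b m k {w} → w ∈ increasingWords b m k → IncreasingWord b (b + k * m) k w
∈-increasingWords⁻ b m zero    (here refl) = record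
  { length≡ = refl ; increasing = [] ; lower = [] ; upper = [] }
∈-increasingWords⁻ b m (suc k) w∈
  with ∈-cartesianProductWith⁻ _∷_ (applyUpTo (λ i → suc (b + i)) m) (increasingWords (b + m) m k) w∈
... | x , v , x∈ , v∈ , refl with ∈-applyUpTo⁻ (λ i → suc (b + i)) x∈
... | i , i<m , refl = record
  { length≡    = cong suc length≡
  ; increasing = All.map (≤-<-trans x≤b+m) lower ∷ increasing
  ; lower      = s≤s (m≤m+n b i) ∷ All.map (≤-<-trans (m≤m+n b m)) lower
  ; upper      = ≤-trans x≤b+m (+-monoʳ-≤ b (m≤m+n m (k * m)))
               ∷ All.map (λ y≤ → ≤-trans y≤ (≤-reflexive (+-assoc b m (k * m)))) upper
  }
  where
  open IncreasingWord (∈-increasingWords⁻ (b + m) m k v∈)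
  x≤b+m : suc (b + i) ≤ b + m
  x≤b+m = +-monoʳ-< b i<m

-- Words with a conflict.

-- A superset of the letters that conflict with some letter of w: 2 and n are
-- always included, so that the length depends only on that of w.
conflicts : ℕ → List ℕ → List ℕ
conflicts n w = 2 ∷ n ∷ w ++ map suc w ++ map pred w

-- Either the tail is already bad and the first letter is free, or the tail is free and the first
-- letter is one of its `conflicts`. Repetitions and words without a genuine conflict may occur: the
-- list serves as an upper bound.
badWords : ℕ → ℕ → List (List ℕ)
badWords n zero    = []
badWords n (suc k) =
  cartesianProductWith _∷_ (oneTo n) (badWords n k) ++
  concatMap (λ w → map (_∷ w) (conflicts n w)) (words (oneTo n) k)

length-conflicts : ∀ n w → length (conflicts n w) ≡ 2 + 3 * length w
length-conflicts n w = cong (suc ∘ suc) (begin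
  length (w ++ map suc w ++ map pred w)
    ≡⟨ length-++ w ⟩
  length w + length (map suc w ++ map pred w)
    ≡⟨ cong (length w +_) (length-++ (map suc w)) ⟩
  length w + (length (map suc w) + length (map pred w))
    ≡⟨ cong (length w +_) (cong₂ _+_ (length-map suc w) (trans (length-map pred w) (sym (+-identityʳ _)))) ⟩
  3 * length w ∎)
  where open ≡-Reasoning

words-length : ∀ xs k {w} → w ∈ words xs k → length w ≡ k
words-length xs zero    (here refl) = refl
words-length xs (suc k) w∈ with ∈-cartesianProductWith⁻ _∷_ xs (words xs k) w∈
... | _ , _ , _ , v∈ , refl = cong suc (words-length xs k v∈)

length-words : ∀ xs k → length (words xs k) ≡ length xs ^ k
length-words xs zero    = refl
length-words xs (suc k) = trans (length-cartesianProductWith _∷_ xs (words xs k))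
  (cong (length xs *_) (length-words xs k))

-- The sum of 2 + 3j over j < k, where 2 + 3j counts the candidates for a letter in conflict with
-- the j letters after it.
badCoefficient : ℕ → ℕ
badCoefficient zero    = 0
badCoefficient (suc k) = badCoefficient k + (2 + 3 * k)

-- The extra factor `n` on the left replaces the exponent k - 1, which would need a separate
-- convention at k = 0.
length-badWords : ∀ n k → length (badWords n k) * n ≡ badCoefficient k * n ^ k
length-badWords n zero    = refl
length-badWords n (suc k) = begin
  length (badWords n (suc k)) * n
    ≡⟨ cong (_* n) (length-++ (cartesianProductWith _∷_ (oneTo n) (badWords n k))) ⟩
  (length (cartesianProductWith _∷_ (oneTo n) (badWords n k)) + length extensions) * n
    ≡⟨ cong (_* n) (cong₂ _+_
         (trans (length-cartesianProductWith _∷_ (oneTo n) (badWords n k))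
                (cong (_* length (badWords n k)) (length-applyUpTo suc n)))
         (trans (length-concatMap _ (All.tabulate λ {w} w∈ → trans (length-map (_∷ w) (conflicts n w))
                  (trans (length-conflicts n w) (cong (λ l → 2 + 3 * l) (words-length (oneTo n) k w∈)))))
                (cong (_* (2 + 3 * k)) (trans (length-words (oneTo n) k)
                  (cong (_^ k) (length-applyUpTo suc n)))))) ⟩
  (n * length (badWords n k) + n ^ k * (2 + 3 * k)) * n
    ≡⟨ regroup n (length (badWords n k)) (n ^ k) (2 + 3 * k) ⟩
  n * (length (badWords n k) * n) + (2 + 3 * k) * (n * n ^ k)
    ≡⟨ cong (λ l → n * l + (2 + 3 * k) * (n * n ^ k)) (length-badWords n k) ⟩
  n * (badCoefficient k * n ^ k) + (2 + 3 * k) * (n * n ^ k)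
    ≡⟨ factor n (badCoefficient k) (n ^ k) (2 + 3 * k) ⟩
  badCoefficient (suc k) * n ^ suc k ∎
  where
  open ≡-Reasoning
  extensions : List (List ℕ)
  extensions = concatMap (λ w → map (_∷ w) (conflicts n w)) (words (oneTo n) k)
  regroup : ∀ n b e d → (n * b + e * d) * n ≡ n * (b * n) + d * (n * e)
  regroup = solve-∀
  factor : ∀ n c e d → n * (c * e) + d * (n * e) ≡ (c + d) * (n * e)
  factor = solve-∀

2≤∣x-y∣ : ∀ {x y} → x ≢ y → x ≢ suc y → suc x ≢ y → 2 ≤ ∣ x - y ∣
2≤∣x-y∣ {zero}        {zero}        x≢y _     _     = contradiction refl x≢y
2≤∣x-y∣ {zero}        {suc zero}    _   _     x+1≢y = contradiction refl x+1≢y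
2≤∣x-y∣ {zero}        {suc (suc y)} _   _     _     = s≤s (s≤s z≤n)
2≤∣x-y∣ {suc zero}    {zero}        _   x≢y+1 _     = contradiction refl x≢y+1
2≤∣x-y∣ {suc (suc x)} {zero}        _   _     _     = s≤s (s≤s z≤n)
2≤∣x-y∣ {suc x}       {suc y}       x≢y x≢y+1 x+1≢y =
  2≤∣x-y∣ (x≢y ∘ cong suc) (x≢y+1 ∘ cong suc) (x+1≢y ∘ cong suc)

∉-conflicts⇒gap : ∀ {n w x y} → x ∉ conflicts n w → y ∈ w → 2 ≤ ∣ x - y ∣
∉-conflicts⇒gap {n} {w} {x} {y} x∉ y∈w = 2≤∣x-y∣ {x} {y}
  (λ { refl → x∉ (there (there (∈-++⁺ˡ y∈w))) })
  (λ { refl → x∉ (there (there (∈-++⁺ʳ w (∈-++⁺ˡ (∈-map⁺ suc y∈w))))) })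
  (λ { refl → x∉ (there (there (∈-++⁺ʳ w (∈-++⁺ʳ (map suc w) (∈-map⁺ pred y∈w))))) })

-- Follows the recursion of `badWords`. If the head is outside `conflicts` and the tail is
-- separated, the head keeps distance 2 from the tail and is neither 2 nor n, so no forbidden pair
-- arises.
bad⊎separated : ∀ {n} → n ≢ 2 → ∀ w → All (_∈ oneTo n) w →
                w ∈ badWords n (length w) ⊎
                (AllPairs (λ x y → 2 ≤ ∣ x - y ∣) w × ¬ (2 ∈ w × n ∈ w))
bad⊎separated n≢2 []      []        = inj₂ ([] , λ ())
bad⊎separated {n} n≢2 (x ∷ w) (x∈ ∷ w⊆) with x ∈? conflicts n w | bad⊎separated n≢2 w w⊆
... | yes x∈c | _        = inj₁ (∈-++⁺ʳ (cartesianProductWith _∷_ (oneTo n) (badWords n (length w)))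
  (∈-concatMap⁺ _ (lose (∈-words w w⊆) (∈-map⁺ (_∷ w) x∈c))))
... | no _    | inj₁ bad = inj₁ (∈-++⁺ˡ (∈-cartesianProductWith⁺ _∷_ x∈ bad))
... | no x∉c  | inj₂ (gaps , not-both) =
  inj₂ (All.tabulate (λ {y} → ∉-conflicts⇒gap {y = y} x∉c) ∷ gaps , λ where
    (here refl , here n≡2)  → n≢2 n≡2
    (here refl , there _)   → x∉c (here refl)
    (there _ , here refl)   → x∉c (there (here refl))
    (there 2∈w , there n∈w) → not-both (2∈w , n∈w))

-- Standard tableaux of shape `ν [ n ]ₚ`: many in all, few bad ones.

module _ {ν n} (p : IsPartition ν) (n> : n > size ν + largest ν) where

  -- All entries of `T` exceed `largest ν`, so the top row starts with 1, ..., `largest ν`, and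
  -- these fill the places above the first row of `T`. The rows further down are handled by the
  -- increasing reading word.
  standard-[]ₜ : ∀ T → shape T ≡ ν → AllPairs _<_ (entries T) →
                 All (largest ν <_) (entries T) → All (_≤ n) (entries T) →
                 IsStandard (ν [ n ]ₚ) (T [ n ]ₜ)
  standard-[]ₜ T refl inc large small = isStandard
    (cong (_∷ shape T) length-top)
    (subst (λ m → entries (T [ n ]ₜ) ↭ oneTo m) (sym (size-[]ₚ {ν} n>)) content)
    (missing-increasing (entries T) n ∷ increasing⇒rows T inc)
    (columns T a≤n large inc (IsPartition.decreasing p))
    where
    content : missing (entries T) n ++ entries T ↭ oneTo n
    content = missing-++-↭ (AllPairs.map <⇒≢ inc) (λ x∈w →
      ∈-oneTo⁺ (≤-<-trans z≤n (All.lookup large x∈w)) (All.lookup small x∈w))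
    length-top : length (missing (entries T) n) ≡ n ∸ size ν
    length-top = begin
      t                         ≡⟨ m+n∸n≡m t (size ν) ⟨
      t + size ν ∸ size ν       ≡⟨ cong (λ s → t + s ∸ size ν) (length-entries T) ⟨
      t + length w ∸ size ν     ≡⟨ cong (_∸ size ν) (length-++ (missing w n)) ⟨
      length (missing w n ++ w) ∸ size ν
        ≡⟨ cong (_∸ size ν) (trans (↭-length content) (length-applyUpTo suc n)) ⟩
      n ∸ size ν                ∎
      where
      open ≡-Reasoning
      w = entries T
      t = length (missing w n)
    a≤n : largest ν ≤ n
    a≤n = ≤-trans (m≤n+m (largest ν) (size ν)) (<⇒≤ n>)
    columns : ∀ T → largest (shape T) ≤ n → All (largest (shape T) <_) (entries T) → AllPairs _<_ (entries T) →
              Linked _≥_ (shape T) → Linked (λ upper lower → Prefix _>_ lower upper) (T [ n ]ₜ)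
    columns []      _     _     _   _ = [-]
    columns (r ∷ T) a≤n large inc d =
      missing-prefix (length r) a≤n large (All.++⁻ˡ r large) ≤-refl ∷ increasing⇒columns (r ∷ T) d inc

  -- The top row is increasing and contains exactly what the lower rows omit, and two sorted lists
  -- that are permutations of each other coincide.
  standard⇒≡[]ₜ : ∀ {U} → IsStandard (ν [ n ]ₚ) U → U ≡ drop 1 U [ n ]ₜ
  standard⇒≡[]ₜ {r ∷ T} (isStandard _ content (r↗ ∷ _) _) = cong (_∷ T)
    (Pointwise-≡⇒≡ (↗↭↗⇒≋ ≤-totalOrder (Linked.map <⇒≤ r↗)
      (Linked.map <⇒≤ (missing-increasing w n)) (↭⇒↭ₛ r↭missing)))
    where
    w = entries T
    content′ : r ++ w ↭ oneTo n
    content′ = subst (λ m → r ++ w ↭ oneTo m) (size-[]ₚ {ν} n>) content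
    disjoint : All (_∉ w) r
    disjoint = All.map (λ x≢w x∈w → All.lookup x≢w x∈w refl) (proj₂ (proj₂ (AllPairs-++⁻ r
      (Unique-resp-↭ (setoid ℕ) (↭⇒↭ₛ (↭-sym content′)) (oneTo-unique n)))))
    -- Filtering by absence from `w` turns `r ++ w` into `r` and `oneTo n` into the missing numbers;
    -- applied to `content′` this gives `r↭missing`.
    filter-r++w : filter (∉? w) (r ++ w) ≡ r
    filter-r++w = begin
      filter (∉? w) (r ++ w)              ≡⟨ filter-++ (∉? w) r w ⟩
      filter (∉? w) r ++ filter (∉? w) w  ≡⟨ cong₂ _++_ (filter-all (∉? w) disjoint)
                                         (filter-none (∉? w) (All.tabulate λ x∈w x∉w → x∉w x∈w)) ⟩
      r ++ []                             ≡⟨ ++-identityʳ r ⟩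
      r                                   ∎
      where open ≡-Reasoning
    r↭missing : r ↭ missing w n
    r↭missing = subst (_↭ missing w n) filter-r++w (filter-↭ (∉? w) content′)

  -- The hypothesis says that `size ν` blocks of length m fit into the numbers above `largest ν` and
  -- up to n. Each increasing word from these blocks, cut into rows, is the lower part of a standard
  -- tableau.
  many-standard : ∀ m → largest ν + size ν * m ≤ n → m ^ size ν ≤ N ν n
  many-standard m fits = begin
    m ^ size ν
      ≡⟨ length-increasingWords (largest ν) m (size ν) ⟨
    length (increasingWords (largest ν) m (size ν))
      ≤⟨ Unique∧⊆⇒length≤ (increasingWords-unique (largest ν) m (size ν)) readings ⟩
    length (map (entries ∘ drop 1) (standardTableaux (ν [ n ]ₚ)))
      ≡⟨ length-map (entries ∘ drop 1) (standardTableaux (ν [ n ]ₚ)) ⟩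
    N ν n ∎
    where
    open ≤-Reasoning
    readings : increasingWords (largest ν) m (size ν) ⊆
               map (entries ∘ drop 1) (standardTableaux (ν [ n ]ₚ))
    readings {w} w∈ = subst (_∈ map (entries ∘ drop 1) (standardTableaux (ν [ n ]ₚ))) entries≡w
      (∈-map⁺ (entries ∘ drop 1) (Equivalence.from ∈-standardTableaux
        (standard-[]ₜ (splitRows ν w) (shape-splitRows ν w length≡)
          (subst (AllPairs _<_) (sym entries≡w) increasing)
          (subst (All (largest ν <_)) (sym entries≡w) lower)
          (subst (All (_≤ n)) (sym entries≡w) (All.map (λ x≤ → ≤-trans x≤ fits) upper)))))
      where
      open IncreasingWord (∈-increasingWords⁻ (largest ν) m (size ν) w∈)
      entries≡w : entries (splitRows ν w) ≡ w
      entries≡w = entries-splitRows ν w length≡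

  badTableaux : List Tableau
  badTableaux = filter (¬? ∘ isGood? n) (standardTableaux (ν [ n ]ₚ))

  -- A standard `U` equals `T [ n ]ₜ` for its lower part `T`, so it can only fail to be good if `T`
  -- is not separated. The reading word of `T` is then bad, and `U` is rebuilt from it.
  bad-reading : n ≢ 2 → ∀ {U} → IsStandard (ν [ n ]ₚ) U → ¬ IsGood n U →
                U ∈ map (λ w → splitRows ν w [ n ]ₜ) (badWords n (size ν))
  bad-reading n≢2 {r ∷ T} st@(isStandard hasShape content _ _) ¬good =
    subst (_∈ map (λ w → splitRows ν w [ n ]ₜ) (badWords n (size ν))) T[n]≡U
      (∈-map⁺ (λ w → splitRows ν w [ n ]ₜ) (fromInj₁ (λ (gaps , not-2-n) →
        contradiction (T , standard⇒≡[]ₜ st , separated gaps not-2-n) ¬good) bad⊎good))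
    where
    shape≡ν : shape T ≡ ν
    shape≡ν = proj₂ (∷-injective hasShape)
    T[n]≡U : splitRows ν (entries T) [ n ]ₜ ≡ r ∷ T
    T[n]≡U = begin
      splitRows ν (entries T) [ n ]ₜ          ≡⟨ cong (λ μ → splitRows μ (entries T) [ n ]ₜ) shape≡ν ⟨
      splitRows (shape T) (entries T) [ n ]ₜ  ≡⟨ cong (_[ n ]ₜ) (splitRows-entries T) ⟩
      T [ n ]ₜ                                ≡⟨ standard⇒≡[]ₜ st ⟨
      r ∷ T                                   ∎
      where open ≡-Reasoning
    entries⊆ : All (_∈ oneTo n) (entries T)
    entries⊆ = All.++⁻ʳ r (All.tabulate λ {x} x∈ →
      subst (λ m → x ∈ oneTo m) (size-[]ₚ {ν} n>) (∈-resp-↭ content x∈))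
    bad⊎good : entries T ∈ badWords n (size ν) ⊎
               (AllPairs (λ x y → 2 ≤ ∣ x - y ∣) (entries T) × ¬ (2 ∈ entries T × n ∈ entries T))
    bad⊎good = subst (λ k → entries T ∈ badWords n k ⊎ _)
      (trans (length-entries T) (cong size shape≡ν)) (bad⊎separated n≢2 (entries T) entries⊆)

  G+bad≡N : G ν n + length badTableaux ≡ N ν n
  G+bad≡N = length-filter-¬ (isGood? n) (standardTableaux (ν [ n ]ₚ))

  badTableaux⊆ : n ≢ 2 → badTableaux ⊆ map (λ w → splitRows ν w [ n ]ₜ) (badWords n (size ν))
  badTableaux⊆ n≢2 U∈ =
    let U∈st , ¬good = ∈-filter⁻ (¬? ∘ isGood? n) {xs = standardTableaux (ν [ n ]ₚ)} U∈
    in bad-reading n≢2 (Equivalence.to ∈-standardTableaux U∈st) ¬good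

  few-bad : n ≢ 2 → length badTableaux * n ≤ badCoefficient (size ν) * n ^ size ν
  few-bad n≢2 = begin
    length badTableaux * n
      ≤⟨ *-monoˡ-≤ n (Unique∧⊆⇒length≤
           (Unique.filter⁺ (¬? ∘ isGood? n) (standardTableaux-unique (ν [ n ]ₚ))) (badTableaux⊆ n≢2)) ⟩
    length (map (λ w → splitRows ν w [ n ]ₜ) (badWords n (size ν))) * n
      ≡⟨ cong (_* n) (length-map _ (badWords n (size ν))) ⟩
    length (badWords n (size ν)) * n
      ≡⟨ length-badWords n (size ν) ⟩
    badCoefficient (size ν) * n ^ size ν ∎
    where open ≤-Reasoning

-- Comparison of the two bounds for large n.

^-distribʳ-* : ∀ m n o → (m * n) ^ o ≡ m ^ o * n ^ o
^-distribʳ-* m n zero    = refl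
^-distribʳ-* m n (suc o) = trans (cong (m * n *_) (^-distribʳ-* m n o)) (swap m n (m ^ o) (n ^ o))
  where
  swap : ∀ m n x y → m * n * (x * y) ≡ m * x * (n * y)
  swap = solve-∀

-- The remainder is less than d, and d is at most (n / d) * d because the quotient is positive. Thus
-- a block length n / d is proportional to n.
n≤2*[n/d]*d : ∀ n d .{{_ : NonZero d}} → d ≤ n → n ≤ 2 * d * (n / d)
n≤2*[n/d]*d n d d≤n = begin
  n                      ≡⟨ m≡m%n+[m/n]*n n d ⟩
  n % d + n / d * d      ≤⟨ +-monoˡ-≤ (n / d * d) (<⇒≤ (m%n<n n d)) ⟩
  d + n / d * d          ≤⟨ +-monoˡ-≤ (n / d * d) (m≤n*m d (n / d) {{>-nonZero (m≥n⇒m/n>0 d≤n)}}) ⟩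
  n / d * d + n / d * d  ≡⟨ double (n / d) d ⟩
  2 * d * (n / d)        ∎
  where
  open ≤-Reasoning
  double : ∀ m d → m * d + m * d ≡ 2 * d * m
  double = solve-∀

module _ (ν : List ℕ) (q : ℕ) where

  -- With block length n / `scale`, all blocks together with the initial `largest ν` numbers fit
  -- into 1, ..., n; the successor makes the divisor nonzero.
  scale : ℕ
  scale = suc (largest ν + size ν)

  -- The summand 3 rules out n = 2, `scale` makes the block length positive, and the product is the
  -- constant left over when the two bounds are compared.
  threshold : ℕ
  threshold = 3 + scale + badCoefficient (size ν) * (2 * scale) ^ size ν * q

  -- The proportion of bad tableaux is below 1/q. After multiplication by n, both bounds involve the
  -- k-th power of the block length m, since n is at most 2 * `scale` * m; what remains is a
  -- constant smaller than n.
  bad-negligible : (p : IsPartition ν) → ∀ {n} (n> : n > size ν + largest ν) → n ≥ threshold →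
                   length (badTableaux p n>) * q < N ν n
  bad-negligible p {n} n> n≥ = *-cancelʳ-< n (length (badTableaux p n>) * q) (N ν n) (begin-strict
    length (badTableaux p n>) * q * n  ≡⟨ *-swapʳ (length (badTableaux p n>)) q n ⟩
    length (badTableaux p n>) * n * q  ≤⟨ *-monoˡ-≤ q (few-bad p n> n≢2) ⟩
    c * n ^ k * q                      ≤⟨ *-monoˡ-≤ q (*-monoʳ-≤ c (^-monoˡ-≤ k (n≤2*[n/d]*d n scale scale≤n))) ⟩
    c * (2 * scale * m) ^ k * q       ≡⟨ cong (λ x → c * x * q) (^-distribʳ-* (2 * scale) m k) ⟩
    c * ((2 * scale) ^ k * m ^ k) * q ≡⟨ regroup c ((2 * scale) ^ k) (m ^ k) q ⟩
    m ^ k * (c * (2 * scale) ^ k * q) ≤⟨ *-monoˡ-≤ _ (many-standard p n> m fits) ⟩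
    N ν n * (c * (2 * scale) ^ k * q) <⟨ *-monoʳ-< (N ν n) {{N-nonZero p n>}} (<-≤-trans (m<n+m _ z<s) n≥) ⟩
    N ν n * n                          ∎)
    where
    open ≤-Reasoning
    k = size ν
    c = badCoefficient k
    m = n / scale
    n≢2 : n ≢ 2
    n≢2 = >⇒≢ (≤-trans (s≤s (s≤s (s≤s z≤n))) n≥)
    scale≤n : scale ≤ n
    scale≤n = ≤-trans (≤-trans (m≤n+m scale 3) (m≤m+n (3 + scale) _)) n≥
    fits : largest ν + k * m ≤ n
    fits = begin
      -- Since m is at least 1, `largest ν` can be absorbed into a multiple of m.
      largest ν + k * m      ≤⟨ +-monoˡ-≤ (k * m) (m≤m*n (largest ν) m {{>-nonZero (m≥n⇒m/n>0 scale≤n)}}) ⟩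
      largest ν * m + k * m  ≡⟨ *-distribʳ-+ m (largest ν) k ⟨
      (largest ν + k) * m    ≤⟨ *-monoˡ-≤ m (n≤1+n (largest ν + k)) ⟩
      scale * m             ≡⟨ *-comm scale m ⟩
      m * scale             ≤⟨ m/n*n≤m n scale ⟩
      n                      ∎
    *-swapʳ : ∀ b q n → b * q * n ≡ b * n * q
    *-swapʳ = solve-∀
    regroup : ∀ c e x q → c * (e * x) * q ≡ x * (c * e * q)
    regroup = solve-∀

-- Passage to rational numbers.

-- The distance is b/t, which is less than the reciprocal of the denominator of ε; a positive
-- rational is at least that reciprocal.
∣g/t-1∣<ε : ∀ {g b t} .{{_ : NonZero t}} ε → ε ℚ.> 0ℚ → g + b ≡ t → b * ℚ.↧ₙ ε < t →
            ℚ.∣ ℤ.+ g ℚ./ t ℚ.- 1ℚ ∣ ℚ.< ε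
∣g/t-1∣<ε (mkℚ (ℤ.+ zero)   _ _) (ℚ.*<* (+<+ ())) _ _
∣g/t-1∣<ε (mkℚ (-[1+ _ ])   _ _) (ℚ.*<* ())       _ _
-- Unnormalised rationals do not cancel common factors, so the numerator and denominator of the
-- difference can be read off.
∣g/t-1∣<ε {g} {b} {suc t} ε@(mkℚ +[1+ p ] d _) _ g+b≡t b*q<t = ℚ.toℚᵘ-cancel-< (begin-strict
  ℚ.toℚᵘ ℚ.∣ r ℚ.- 1ℚ ∣           ≃⟨ ℚ.toℚᵘ-homo-∣-∣ (r ℚ.- 1ℚ) ⟩
  ℚᵘ.∣ ℚ.toℚᵘ (r ℚ.- 1ℚ) ∣        ≃⟨ ℚᵘ.∣-∣-cong (ℚ.toℚᵘ-homo-+ r (ℚ.- 1ℚ)) ⟩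
  ℚᵘ.∣ ℚ.toℚᵘ r ℚᵘ.- 1ℚᵘ ∣        ≃⟨ ℚᵘ.∣-∣-cong (ℚᵘ.+-congˡ (ℚᵘ.- 1ℚᵘ) (ℚ.toℚᵘ-fromℚᵘ g/t)) ⟩
  ℚᵘ.∣ g/t ℚᵘ.- 1ℚᵘ ∣             <⟨ *<* cross ⟩
  ℚ.toℚᵘ ε                        ∎)
  where
  open ℚᵘ.≤-Reasoning
  r = ℤ.+ g ℚ./ suc t
  -- `mkℚᵘ` stores the predecessor of the denominator, which here is `suc t`.
  g/t = mkℚᵘ (ℤ.+ g) t
  numerator : ℤ.∣ ℤ.+ g ℤ.* ℤ.+ 1 ℤ.+ -[1+ 0 ] ℤ.* ℤ.+ suc t ∣ ≡ b
  numerator = trans (cong ℤ.∣_∣ (trans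
      (cong₂ ℤ._+_ (ℤ.*-identityʳ (ℤ.+ g)) (ℤ.-1*i≡-i (ℤ.+ suc t))) (ℤ.m-n≡m⊖n g (suc t))))
    (trans (ℤ.∣⊖∣-≤ (subst (g ≤_) g+b≡t (m≤m+n g b)))
           (trans (cong (_∸ g) (sym g+b≡t)) (m+n∸m≡n g b)))
  b*q<p*t : b * suc d < suc p * (suc t * 1)
  b*q<p*t = <-≤-trans b*q<t (≤-trans (≤-reflexive (sym (*-identityʳ (suc t)))) (m≤n*m (suc t * 1) (suc p)))
  cross : ℤ.+ ℤ.∣ ℤ.+ g ℤ.* ℤ.+ 1 ℤ.+ -[1+ 0 ] ℤ.* ℤ.+ suc t ∣ ℤ.* ℤ.+ suc d ℤ.<
          +[1+ p ] ℤ.* ℤ.+ (suc t * 1)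
  cross = subst₂ ℤ._<_
    (trans (ℤ.pos-* b (suc d)) (cong (λ i → ℤ.+ i ℤ.* ℤ.+ suc d) (sym numerator)))
    (ℤ.pos-* (suc p) (suc t * 1)) (+<+ b*q<p*t)

theorem3p2 : (ν : List ℕ) (p : IsPartition ν) → ν ≢ [] →
    ConvergesTo (size ν + largest ν) (ratio p) 1ℚ
-- The bound on n depends on ε only through its denominator, taken as q.
theorem3p2 ν p _ ε ε>0 = threshold ν (ℚ.↧ₙ ε) , λ n n> n≥ →
  -- The implicit arguments are given because inferring them makes Agda evaluate G and N.
  ∣g/t-1∣<ε {G ν n} {length (badTableaux p n>)} {N ν n} {{N-nonZero p n>}} ε ε>0
    (G+bad≡N p n>) (bad-negligible ν (ℚ.↧ₙ ε) p n> n≥)
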